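{- For every integer $n\ge 6$, writing $k=\lfloor n/4\rfloor$, we have $\mathrm{co}^{+}\mathrm{ex}(n,C_5)=2k$ if $n\equiv 0,1,2 \pmod 4$, and $\mathrm{co}^{+}\mathrm{ex}(n,C_5)=2k+1$ if $n\equiv 3\pmod 4$.
   Context: A $3$-graph $H$ is a hypergraph all of whose edges have size $3$. For a $2$-set $S$ of vertices, its co-degree is the number of edges of $H$ containing $S$. The minimum positive co-degree $\delta_2^{+}(H)$ of a non-empty $3$-graph $H$ is the minimum co-degree over all $2$-sets $S$ whose co-degree is nonzero. For a $3$-graph $F$, the positive co-degree Turán number $\mathrm{co}^{+}\mathrm{ex}(n,F)$ is the maximum of $\delta_2^{+}(H)$ over all $n$-vertex non-empty $3$-graphs $H$ containing no copy of $F$. $C_5$ denotes the $3$-graph on vertices $a,b,c,d,e$ with edges $\{abc, bcd, cde, dea, eab\}$. -}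

module Defs where

open import Data.Nat using (ℕ; _+_; _≤_; _<_)
open import Data.Bool using (Bool; true; false; if_then_else_)
open import Data.Fin using (Fin)
open import Data.List using (List; allFin; map)
open import Data.Nat.ListAction using (sum)
open import Data.Product using (Σ; ∃; ∃-syntax; _×_; _,_)
open import Relation.Binary.PropositionalEquality using (_≡_; _≢_)
open import Relation.Nullary using (¬_)

record 3Graph (n : ℕ) : Set where
  field
    edge     : Fin n → Fin n → Fin n → Bool
    sym₁₂    : ∀ x y z → edge x y z ≡ edge y x z
    sym₂₃    : ∀ x y z → edge x y z ≡ edge x z y
    distinct : ∀ x y z → edge x y z ≡ true → (x ≢ y) × (y ≢ z) × (x ≢ z)

open 3Graph public

codeg : ∀ {n} → 3Graph n → Fin n → Fin n → ℕ
codeg {n} H x y = sum (map (λ z → if edge H x y z then 1 else 0) (allFin n))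

NonEmpty : ∀ {n} → 3Graph n → Set
NonEmpty H = ∃[ x ] ∃[ y ] ∃[ z ] edge H x y z ≡ true

IsMinPosCodeg : ∀ {n} → 3Graph n → ℕ → Set
IsMinPosCodeg H d =
  (∃[ x ] ∃[ y ] (x ≢ y × 0 < codeg H x y × codeg H x y ≡ d))
  × (∀ x y → x ≢ y → 0 < codeg H x y → d ≤ codeg H x y)

ContainsC5 : ∀ {n} → 3Graph n → Set
ContainsC5 {n} H =
  Σ (Fin n) λ a → Σ (Fin n) λ b → Σ (Fin n) λ c → Σ (Fin n) λ d → Σ (Fin n) λ e →
    (a ≢ b × a ≢ c × a ≢ d × a ≢ e × b ≢ c × b ≢ d × b ≢ e × c ≢ d × c ≢ e × d ≢ e)
    × edge H a b c ≡ true × edge H b c d ≡ true × edge H c d e ≡ true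
    × edge H d e a ≡ true × edge H e a b ≡ true

CoPosExC5≡ : ℕ → ℕ → Set
CoPosExC5≡ n m =
  (Σ (3Graph n) λ H → NonEmpty H × ¬ ContainsC5 H × IsMinPosCodeg H m)
  × (∀ (H : 3Graph n) d → NonEmpty H → ¬ ContainsC5 H → IsMinPosCodeg H d → d ≤ m)

{-# OPTIONS --safe #-}
module Submission where

-- Suppose 2d ≥ n. Two pairs of an edge share a further neighbour, which gives a K₄⁻. Summing the six
-- codegrees of a K₄⁻, the link of any vertex on it has at most three edges (the link on a K₄ contains
-- no spanning path, as that would close up to a C₅), so 6d ≤ 3n, with strict inequality if there is
-- no K₄. Hence 2d = n, there is a K₄ pxyz, and of two opposite pairs of it exactly one forms an edge
-- with any given vertex w: the link of w is a triangle or a star. Stars at two different vertices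
-- cannot both occur, say none is centred at x, y, z. A vertex whose link is the triangle missing p
-- then shares no edge with p, and likewise for x. It follows that every vertex of the link graph of
-- p, or of x, has degree d there, and that these two graphs have 3d vertices in total. Their degree
-- sums add up to 3d², which is even by the handshake lemma; so d is even.
-- Lower bounds: the complete 4-partite 3-graph if 4 ∣ n; otherwise, for V = A ∪ B, all triples with
-- exactly one vertex in B.

open import Defs
open import Data.Bool using (Bool; true; false; not; _∧_; _xor_; if_then_else_)
open import Data.Bool.Properties using (¬-not; not-injective; ∧-comm; ∧-zeroʳ; ∧-identityʳ; xor-comm) renaming (_≟_ to _≟ᵇ_)
open import Data.Empty using (⊥)
open import Data.Fin using (Fin; zero; suc; toℕ; fromℕ<) renaming (_<_ to _<ᶠ_)
open import Data.Fin.Patterns using (0F; 1F; 2F; 3F; 4F)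
open import Data.Fin.Properties using (any?; all?; pigeonhole; toℕ-fromℕ<) renaming (_≟_ to _≟ᶠ_)
import Data.List as List
open import Data.List.Properties using (map-tabulate)
open import Data.Nat using (ℕ; zero; suc; _+_; _*_; _≤_; _<_; _/_; _%_; z≤n; s≤s; _≤?_; _<ᵇ_; _≟_)
open import Data.Nat.Divisibility using (_∣_; _∣?_; _∣0; ∣m∣n⇒∣m+n; ∣m+n∣m⇒∣n; m∣m*n; ∣⇒≤)
open import Data.Nat.DivMod using (m≡m%n+[m/n]*n; m%n<n; m≥n⇒m/n>0)
import Data.Nat.ListAction as ListAction
open import Data.Nat.Primality using (prime[2]; euclidsLemma)
open import Data.Nat.Properties hiding (_≟_; _≤?_)
open import Data.Nat.Tactic.RingSolver using (solve-∀)
open import Data.Product using (Σ; ∃-syntax; _×_; _,_; proj₁; proj₂)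
open import Data.Sum using (_⊎_; inj₁; inj₂; [_,_]′)
open import Function using (_∘_; id)
open import Relation.Binary.PropositionalEquality using (_≡_; _≢_; refl; sym; trans; cong; cong₂; subst; subst₂; module ≡-Reasoning)
open import Relation.Nullary using (¬_; yes; no; Dec; does; contradiction)
open import Relation.Nullary.Decidable using (_×-dec_; _⊎-dec_; toWitness; decidable-stable; dec-true; dec-false)

open import Algebra.Properties.Semiring.Sum +-*-semiring using (sum; sum-cong-≗; ∑-distrib-+; *-distribˡ-sum)

-- Finite sums

ι : Bool → ℕ
ι b = if b then 1 else 0

ι≤1 : ∀ b → ι b ≤ 1
ι≤1 true  = ≤-refl
ι≤1 false = z≤n

sum-const : ∀ n k → sum {n} (λ _ → k) ≡ n * k
sum-const zero    k = refl
sum-const (suc n) k = cong (k +_) (sum-const n k)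

sum-mono-≤ : ∀ {n} {f g : Fin n → ℕ} → (∀ i → f i ≤ g i) → sum f ≤ sum g
sum-mono-≤ {zero}  f≤g = z≤n
sum-mono-≤ {suc n} f≤g = +-mono-≤ (f≤g zero) (sum-mono-≤ (f≤g ∘ suc))

sum-mono-< : ∀ {n} {f g : Fin n → ℕ} → (∀ i → f i ≤ g i) → ∀ i → f i < g i → sum f < sum g
sum-mono-< f≤g zero    f<g = +-mono-<-≤ f<g (sum-mono-≤ (f≤g ∘ suc))
sum-mono-< f≤g (suc i) f<g = +-mono-≤-< (f≤g zero) (sum-mono-< (f≤g ∘ suc) i f<g)

sum-list : ∀ {n} (f : Fin n → ℕ) → ListAction.sum (List.tabulate f) ≡ sum f
sum-list {zero}  f = refl
sum-list {suc n} f = cong (f zero +_) (sum-list (f ∘ suc))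

sum-positive : ∀ {n} (f : Fin n → Bool) i → f i ≡ true → 0 < sum (ι ∘ f)
sum-positive {n} f i fi = subst (_< sum (ι ∘ f)) (trans (sum-const n 0) (*-zeroʳ n))
  (sum-mono-< {n} (λ _ → z≤n) i (subst (λ b → 0 < ι b) (sym fi) ≤-refl))

sum-none : ∀ {n} {f : Fin n → Bool} → (∀ i → f i ≡ false) → sum (ι ∘ f) ≡ 0
sum-none {zero}  none = refl
sum-none {suc n} none rewrite none zero = sum-none (none ∘ suc)

-- Induction on the number of vertices: removing vertex `zero` removes a row and a column with the
-- same sum `R`.
handshake : ∀ {n} (f : Fin n → Fin n → ℕ) → (∀ i j → f i j ≡ f j i) → (∀ i → f i i ≡ 0) →
            2 ∣ sum (λ i → sum (f i))
handshake {zero}  f f-sym f-irr = 2 ∣0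
handshake {suc n} f f-sym f-irr = subst (2 ∣_) (sym total)
  (∣m∣n⇒∣m+n (m∣m*n R) (handshake (λ i j → f (suc i) (suc j)) (λ i j → f-sym _ _) (λ i → f-irr _)))
  where
  R rest : ℕ
  R    = sum (λ j → f zero (suc j))
  rest = sum (λ i → sum (λ j → f (suc i) (suc j)))
  total : sum (λ i → sum (f i)) ≡ 2 * R + rest
  total = begin
    (f zero zero + R) + sum (λ i → f (suc i) zero + sum (λ j → f (suc i) (suc j)))
      ≡⟨ cong₂ (λ a b → (a + R) + b) (f-irr zero) (∑-distrib-+ (λ i → f (suc i) zero) _) ⟩
    R + (sum (λ i → f (suc i) zero) + rest)
      ≡⟨ cong (λ a → R + (a + rest)) (sum-cong-≗ (λ i → f-sym (suc i) zero)) ⟩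
    R + (R + rest)
      ≡⟨ rearrange R rest ⟩
    2 * R + rest ∎
    where
    open ≡-Reasoning
    rearrange : ∀ a b → a + (a + b) ≡ 2 * a + b
    rearrange = solve-∀

-- The point `v` lies in neither set, so disjoint sets would have at most n - 1 elements together.
common-element : ∀ {n} (f g : Fin n → Bool) → n ≤ sum (ι ∘ f) + sum (ι ∘ g) →
                 ∀ v → f v ≡ false → g v ≡ false → ∃[ w ] (f w ≡ true × g w ≡ true)
common-element {n} f g large v fv gv with any? (λ w → (f w ≟ᵇ true) ×-dec (g w ≟ᵇ true))
... | yes found = found
... | no  none  = contradiction (≤-<-trans large small) (<-irrefl refl)
  where
  disjoint : ∀ a b → ¬ (a ≡ true × b ≡ true) → ι a + ι b ≤ 1
  disjoint true  true  a∦b = contradiction (refl , refl) a∦b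
  disjoint true  false _   = ≤-refl
  disjoint false b     _   = ι≤1 b
  small : sum (ι ∘ f) + sum (ι ∘ g) < n
  small = begin-strict
    sum (ι ∘ f) + sum (ι ∘ g)       ≡⟨ ∑-distrib-+ (ι ∘ f) (ι ∘ g) ⟨
    sum (λ w → ι (f w) + ι (g w))   <⟨ sum-mono-< {n} (λ w → disjoint (f w) (g w) (none ∘ (w ,_))) v
                                         (subst (_< 1) (sym (cong₂ (λ a b → ι a + ι b) fv gv)) ≤-refl) ⟩
    sum {n} (λ _ → 1)               ≡⟨ sum-const n 1 ⟩
    n * 1                           ≡⟨ *-identityʳ n ⟩
    n                               ∎
    where open ≤-Reasoning

codeg-sum : ∀ {n} (H : 3Graph n) x y → codeg H x y ≡ sum (λ z → ι (edge H x y z))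
codeg-sum H x y = trans (cong ListAction.sum (map-tabulate id f)) (sum-list f)
  where
  f : Fin _ → ℕ
  f z = ι (edge H x y z)

-- Graphs on four vertices, listed as three pairs of opposite edges

edges₄ : (a a′ b b′ c c′ : Bool) → ℕ
edges₄ a a′ b b′ c c′ = (ι a + ι a′) + ((ι b + ι b′) + (ι c + ι c′))

-- Applied with `k` = 0 to links on a K₄, and with `k` = 1 to links on a K₄⁻ when there is no K₄.
OppositeBound : ℕ → (a a′ b b′ c c′ : Bool) → Set
OppositeBound k a a′ b b′ c c′ =
  a ≡ true → a′ ≡ true → (ι b + ι b′) + (ι c + ι c′) ≤ k

opposite-split : ∀ a a′ → (a ≡ true × a′ ≡ true) ⊎ (ι a + ι a′ ≤ 1)
opposite-split true  true  = inj₁ (refl , refl)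
opposite-split true  false = inj₂ ≤-refl
opposite-split false a′    = inj₂ (ι≤1 a′)

module _ {k : ℕ} {a a′ b b′ c c′ : Bool}
         (boundᵃ : OppositeBound k a a′ b b′ c c′)
         (boundᵇ : OppositeBound k b b′ a a′ c c′)
         (boundᶜ : OppositeBound k c c′ a a′ b b′) where

  -- Either some opposite pair is fully present, and its bound applies, or each of the three pairs
  -- contributes at most one edge.
  edges₄-cases : edges₄ a a′ b b′ c c′ ≤ 2 + k
               ⊎ (ι a + ι a′ ≤ 1 × ι b + ι b′ ≤ 1 × ι c + ι c′ ≤ 1)
  edges₄-cases with opposite-split a a′ | opposite-split b b′ | opposite-split c c′
  ... | inj₁ (refl , refl) | _ | _ = inj₁ (+-monoʳ-≤ 2 (boundᵃ refl refl))
  ... | inj₂ _ | inj₁ (refl , refl) | _ =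
        inj₁ (≤-trans (≤-reflexive (move (ι a + ι a′) (ι c + ι c′))) (+-monoʳ-≤ 2 (boundᵇ refl refl)))
    where
    move : ∀ x z → x + (2 + z) ≡ 2 + (x + z)
    move = solve-∀
  ... | inj₂ _ | inj₂ _ | inj₁ (refl , refl) =
        inj₁ (≤-trans (≤-reflexive (move (ι a + ι a′) (ι b + ι b′))) (+-monoʳ-≤ 2 (boundᶜ refl refl)))
    where
    move : ∀ x y → x + (y + 2) ≡ 2 + (x + y)
    move = solve-∀
  ... | inj₂ p | inj₂ q | inj₂ r = inj₂ (p , q , r)

  edges₄≤3 : k ≤ 1 → edges₄ a a′ b b′ c c′ ≤ 3
  edges₄≤3 k≤1 with edges₄-cases
  ... | inj₁ small       = ≤-trans small (+-monoʳ-≤ 2 k≤1)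
  ... | inj₂ (p , q , r) = +-mono-≤ p (+-mono-≤ q r)

  -- For `k` = 0 a full opposite pair would leave only two edges in all, so three edges must come
  -- one from each opposite pair.
  edges₄≡3⇒complementary : k ≡ 0 → 3 ≤ edges₄ a a′ b b′ c c′ → a′ ≡ not a
  edges₄≡3⇒complementary refl large with edges₄-cases
  ... | inj₁ small       = contradiction (≤-trans large small) λ { (s≤s (s≤s ())) }
  ... | inj₂ (p , q , r) = complement a a′ p (+-cancelʳ-≤ 2 1 _ (≤-trans large (+-monoʳ-≤ _ (+-mono-≤ q r))))
    where
    complement : ∀ a a′ → ι a + ι a′ ≤ 1 → 1 ≤ ι a + ι a′ → a′ ≡ not a
    complement true  true  (s≤s ()) _
    complement true  false _ _  = refl
    complement false true  _ _  = refl
    complement false false _ ()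

count-none : ∀ {b b′ c c′} → b ≢ true → b′ ≢ true → c ≢ true → c′ ≢ true →
             (ι b + ι b′) + (ι c + ι c′) ≤ 0
count-none p q r s with ¬-not p | ¬-not q | ¬-not r | ¬-not s
... | refl | refl | refl | refl = z≤n

count-one : ∀ {b b′ c c′} → b′ ≢ true → c′ ≢ true → (b ≡ true → c ≢ true) →
            (ι b + ι b′) + (ι c + ι c′) ≤ 1
count-one {false} {_} {c} q s bc with ¬-not q | ¬-not s
... | refl | refl = ≤-trans (≤-reflexive (+-identityʳ (ι c))) (ι≤1 c)
count-one {true} q s bc with ¬-not q | ¬-not (bc refl) | ¬-not s
... | refl | refl | refl = ≤-refl

at-most-one : ∀ {a b c} → (a ≡ true → b ≢ true) → (a ≡ true → c ≢ true) → (b ≡ true → c ≢ true) →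
              ι a + (ι b + ι c) ≤ 1
at-most-one {true}  {b} {c} ab ac bc with ¬-not (ab refl) | ¬-not (ac refl)
... | refl | refl = ≤-refl
at-most-one {false} {true}  ab ac bc with ¬-not (bc refl)
... | refl = ≤-refl
at-most-one {false} {false} {c} ab ac bc = ι≤1 c

-- C₅-free 3-graphs whose positive co-degrees are at least n/2.

module C5Free {n : ℕ} (H : 3Graph n) (free : ¬ ContainsC5 H) (d : ℕ)
              (codeg≥d : ∀ x y → x ≢ y → 0 < codeg H x y → d ≤ codeg H x y)
              (n≤2d : n ≤ d + d) where

  e : Fin n → Fin n → Fin n → Bool
  e = edge H

  E : Fin n → Fin n → Fin n → Set
  E x y z = edge H x y z ≡ true

  E-dec : ∀ x y z → E x y z ⊎ ¬ E x y z
  E-dec x y z with edge H x y z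
  ... | true  = inj₁ refl
  ... | false = inj₂ λ ()

  e132 : ∀ {x y z} → e x y z ≡ e x z y
  e132 = sym₂₃ H _ _ _

  e213 : ∀ {x y z} → e x y z ≡ e y x z
  e213 = sym₁₂ H _ _ _

  e231 : ∀ {x y z} → e x y z ≡ e y z x
  e231 = trans e213 e132

  e312 : ∀ {x y z} → e x y z ≡ e z x y
  e312 = trans e132 e213

  e321 : ∀ {x y z} → e x y z ≡ e z y x
  e321 = trans e213 e312

  E132 : ∀ {x y z} → E x y z → E x z y
  E132 = trans (sym e132)

  E213 : ∀ {x y z} → E x y z → E y x z
  E213 = trans (sym e213)

  E231 : ∀ {x y z} → E x y z → E y z x
  E231 = trans (sym e231)

  E312 : ∀ {x y z} → E x y z → E z x y
  E312 = trans (sym e312)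

  E321 : ∀ {x y z} → E x y z → E z y x
  E321 = trans (sym e321)

  e-xyx : ∀ x y → e x y x ≡ false
  e-xyx x y = ¬-not λ h → proj₂ (proj₂ (distinct H x y x h)) refl

  e-xyy : ∀ x y → e x y y ≡ false
  e-xyy x y = ¬-not λ h → proj₁ (proj₂ (distinct H x y y h)) refl

  -- Any two vertices of a C₅ lie in a common edge, so the five edges already give distinctness.
  no-C5 : ∀ {v w x y z} → E v w x → E w x y → E x y z → E y z v → E z v w → ⊥
  no-C5 {v} {w} {x} {y} {z} vwx wxy xyz yzv zvw
    with distinct H v w x vwx | distinct H w x y wxy | distinct H x y z xyz
       | distinct H y z v yzv | distinct H z v w zvw
  ... | v≢w , w≢x , v≢x | _ , x≢y , w≢y | _ , y≢z , x≢z | _ , z≢v , y≢v | _ , _ , z≢w =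
    free (v , w , x , y , z ,
          (v≢w , v≢x , y≢v ∘ sym , z≢v ∘ sym , w≢x , w≢y , z≢w ∘ sym , x≢y , x≢z , y≢z) ,
          vwx , wxy , xyz , yzv , zvw)

  -- Co-degrees, and links on a K₄⁻ or a K₄.

  cd : Fin n → Fin n → ℕ
  cd x y = sum (λ z → ι (e x y z))

  cd≥d : ∀ {x y z} → E x y z → d ≤ cd x y
  cd≥d {x} {y} {z} xyz = subst (d ≤_) (codeg-sum H x y)
    (codeg≥d x y (proj₁ (distinct H x y z xyz))
      (subst (0 <_) (sym (codeg-sum H x y)) (sum-positive (e x y) z xyz)))

  common-neighbour : ∀ {v x y} → E v x y → ∃[ w ] (E v x w × E v y w)
  common-neighbour {v} {x} {y} vxy = common-element (e v x) (e v y)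
    (≤-trans n≤2d (+-mono-≤ (cd≥d vxy) (cd≥d (E132 vxy)))) v (e-xyx v x) (e-xyx v y)

  -- K4⁻ leaves open whether xyz is an edge.
  K4⁻ : (c x y z : Fin n) → Set
  K4⁻ c x y z = E c x y × E c x z × E c y z

  K4 : (a b c d : Fin n) → Set
  K4 a b c d = E a b c × E a b d × E a c d × E b c d

  -- The number of edges in the link of `w` on the four vertices, the six pairs being grouped as
  -- opposite ones.
  link-size : (c x y z w : Fin n) → ℕ
  link-size c x y z w = edges₄ (e c x w) (e y z w) (e c y w) (e x z w) (e c z w) (e x y w)

  -- The three edges at `c` cover all six pairs, so each pair has co-degree at least `d`, and 6d ≥
  -- 3n.
  link-size-total : ∀ {c x y z} → K4⁻ c x y z → n * 3 ≤ sum (link-size c x y z)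
  link-size-total {c} {x} {y} {z} (cxy , cxz , cyz) = begin
    n * 3                        ≡⟨ triple n ⟩
    n + (n + n)                  ≤⟨ +-mono-≤ (pair cxy (E231 cyz)) (+-mono-≤ (pair cyz (E231 cxz)) (pair (E132 cxz) (E231 cxy))) ⟩
    (cd c x + cd y z) + ((cd c y + cd x z) + (cd c z + cd x y)) ≡⟨ distribute ⟨
    sum (link-size c x y z)      ∎
    where
    open ≤-Reasoning
    triple : ∀ k → k * 3 ≡ k + (k + k)
    triple = solve-∀
    pair : ∀ {p q r s t u} → E p q r → E s t u → n ≤ cd p q + cd s t
    pair pqr stu = ≤-trans n≤2d (+-mono-≤ (cd≥d pqr) (cd≥d stu))
    I : Fin n → Fin n → Fin n → ℕ
    I p q w = ι (e p q w)
    distribute : sum (link-size c x y z) ≡ (cd c x + cd y z) + ((cd c y + cd x z) + (cd c z + cd x y))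
    distribute = trans (∑-distrib-+ (λ w → I c x w + I y z w) _)
      (cong₂ _+_ (∑-distrib-+ (I c x) (I y z))
        (trans (∑-distrib-+ (λ w → I c y w + I x z w) _)
          (cong₂ _+_ (∑-distrib-+ (I c y) (I x z)) (∑-distrib-+ (I c z) (I x y)))))

  -- The average over `w` is at least three by `link-size-total`, so an upper bound of three is
  -- attained everywhere.
  link-size≥3 : ∀ {c x y z} → K4⁻ c x y z → (∀ w → link-size c x y z w ≤ 3) → ∀ w → 3 ≤ link-size c x y z w
  link-size≥3 {c} {x} {y} {z} near ≤3 w with 3 ≤? link-size c x y z w
  ... | yes 3≤ = 3≤
  ... | no ¬3≤ = contradiction
    (≤-<-trans (link-size-total near)
      (subst (sum (link-size c x y z) <_) (sum-const n 3) (sum-mono-< {n} ≤3 w (≰⇒> ¬3≤))))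
    (<-irrefl refl)

  -- The C₅ is w, c, d, a, b. Besides the path a, b, c, d in the link of `w`, it uses the two
  -- triples through both ends of the path; on a K₄⁻ these are edges whenever the apex is an end.
  no-link-path : ∀ {w a b c d} → E a b w → E b c w → E c d w → E a c d → E a b d → ⊥
  no-link-path abw bcw cdw acd abd = no-C5 (E312 cdw) (E231 acd) (E312 abd) abw (E132 bcw)

  Bound : ℕ → (c x y z w : Fin n) → Set
  Bound k c x y z w = OppositeBound k (e c x w) (e y z w) (e c y w) (e x z w) (e c z w) (e x y w)

  -- Any further pair in the link of `w` would join the opposite pairs `c x` and `y z` into a
  -- spanning path.
  K4-bound : ∀ {c x y z} → K4 c x y z → ∀ w → Bound 0 c x y z w
  K4-bound (cxy , cxz , cyz , xyz) w cxw yzw = count-none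
    (λ cyw → no-link-path (E213 cxw) cyw yzw xyz (E213 cxz))
    (λ xzw → no-link-path cxw xzw (E213 yzw) (E132 cyz) cxy)
    (λ czw → no-link-path (E213 cxw) czw (E213 yzw) (E132 xyz) (E213 cxy))
    (λ xyw → no-link-path cxw xyw yzw cyz cxz)

  -- The pairs `x z` and `x y` would each give a spanning path ending at the apex `c`. If `c y` and
  -- `c z` were both in the link, then `c`, `y`, `z`, `w` would span a K₄.
  K4⁻-bound : (∀ {a b c d} → ¬ K4 a b c d) → ∀ {c x y z} → K4⁻ c x y z → ∀ w → Bound 1 c x y z w
  K4⁻-bound none (cxy , cxz , cyz) w cxw yzw = count-one
    (λ xzw → no-link-path cxw xzw (E213 yzw) (E132 cyz) cxy)
    (λ xyw → no-link-path cxw xyw yzw cyz cxz)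
    (λ cyw czw → none (cyz , cyw , czw , yzw))

  module _ {k c x y z w} (b₁ : Bound k c x y z w) (b₂ : Bound k c y x z w) (b₃ : Bound k c z x y w) where
    private
      b₂′ : OppositeBound k (e c y w) (e x z w) (e c x w) (e y z w) (e c z w) (e x y w)
      b₂′ = subst (OppositeBound k (e c y w) (e x z w) (e c x w) (e y z w) (e c z w)) e213 b₂

      b₃′ : OppositeBound k (e c z w) (e x y w) (e c x w) (e y z w) (e c y w) (e x z w)
      b₃′ = subst₂ (λ s t → OppositeBound k (e c z w) (e x y w) (e c x w) s (e c y w) t) e213 e213 b₃

    link-size≤3 : k ≤ 1 → link-size c x y z w ≤ 3
    link-size≤3 = edges₄≤3 {k} {e c x w} {e y z w} {e c y w} {e x z w} {e c z w} {e x y w} b₁ b₂′ b₃′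

    link-size≡3⇒complementary : k ≡ 0 → 3 ≤ link-size c x y z w → e y z w ≡ not (e c x w)
    link-size≡3⇒complementary =
      edges₄≡3⇒complementary {k} {e c x w} {e y z w} {e c y w} {e x z w} {e c z w} {e x y w} b₁ b₂′ b₃′

  -- Without a K₄ all links on the four vertices have exactly three edges. But the link of `x`
  -- consists of `c y` and `c z` alone, since `y z` would complete a K₄.
  K4⁻⇒¬¬K4 : ∀ {c x y z} → K4⁻ c x y z → ¬ (∀ {a b c d} → ¬ K4 a b c d)
  K4⁻⇒¬¬K4 {c} {x} {y} {z} near@(cxy , cxz , cyz) none =
    contradiction (subst (3 ≤_) at-x (link-size≥3 near bounded x)) λ { (s≤s (s≤s ())) }
    where
    bounded : ∀ w → link-size c x y z w ≤ 3
    bounded w = link-size≤3 {1} {c} {x} {y} {z} {w} (K4⁻-bound none near w)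
      (K4⁻-bound none (E132 cxy , cyz , cxz) w) (K4⁻-bound none (E132 cxz , E132 cyz , cxy) w) ≤-refl
    yzx : e y z x ≡ false
    yzx = ¬-not λ yzx → none (cxy , cxz , cyz , E312 yzx)
    at-x : link-size c x y z x ≡ 2
    at-x rewrite e-xyy c x | yzx | E132 cxy | e-xyx x z | E132 cxz | e-xyx x y = refl

  -- Opposite pairs of a K₄.

  swap₁₂ : ∀ {p x y z} → K4 p x y z → K4 x p y z
  swap₁₂ (pxy , pxz , pyz , xyz) = E213 pxy , E213 pxz , xyz , pyz

  swap₂₃ : ∀ {p x y z} → K4 p x y z → K4 p y x z
  swap₂₃ (pxy , pxz , pyz , xyz) = E132 pxy , pyz , pxz , E213 xyz

  swap₃₄ : ∀ {p x y z} → K4 p x y z → K4 p x z y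
  swap₃₄ (pxy , pxz , pyz , xyz) = pxz , pxy , E132 pyz , E132 xyz

  -- On a K₄ every link has at most three edges and they average at least three, so each contains
  -- exactly one of any two opposite pairs.
  complementary : ∀ {p x y z} → K4 p x y z → ∀ w → e y z w ≡ not (e p x w)
  complementary {p} {x} {y} {z} Q@(pxy , pxz , pyz , xyz) w =
    link-size≡3⇒complementary {0} {p} {x} {y} {z} {w} (K4-bound Q w) (K4-bound Q′ w) (K4-bound Q″ w) refl
      (link-size≥3 (pxy , pxz , pyz)
        (λ w → link-size≤3 {0} {p} {x} {y} {z} {w} (K4-bound Q w) (K4-bound Q′ w) (K4-bound Q″ w) z≤n) w)
    where
    Q′ : K4 p y x z
    Q′ = swap₂₃ Q
    Q″ : K4 p z x y
    Q″ = swap₂₃ (swap₃₄ Q)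

  K4-cd-sum : ∀ {p x y z} → K4 p x y z → cd p x + cd y z ≡ n
  K4-cd-sum {p} {x} {y} {z} Q = begin
    cd p x + cd y z                           ≡⟨ ∑-distrib-+ (ι ∘ e p x) (ι ∘ e y z) ⟨
    sum (λ w → ι (e p x w) + ι (e y z w))     ≡⟨ sum-cong-≗ (λ w → trans (cong (λ b → ι (e p x w) + ι b) (complementary Q w)) (one (e p x w))) ⟩
    sum {n} (λ _ → 1)                         ≡⟨ sum-const n 1 ⟩
    n * 1                                     ≡⟨ *-identityʳ n ⟩
    n                                         ∎
    where
    open ≡-Reasoning
    one : ∀ b → ι b + ι (not b) ≡ 1
    one true  = refl
    one false = refl

  K4⇒2d≡n : ∀ {p x y z} → K4 p x y z → d + d ≡ n
  K4⇒2d≡n Q@(pxy , _ , _ , xyz) =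
    ≤-antisym (subst (d + d ≤_) (K4-cd-sum Q) (+-mono-≤ (cd≥d pxy) (cd≥d (E231 xyz)))) n≤2d

  K4⇒cd≡d : ∀ {p x y z} → K4 p x y z → cd p x ≡ d
  K4⇒cd≡d {p} {x} {y} {z} Q@(pxy , _ , _ , xyz) = ≤-antisym
    (+-cancelʳ-≤ d (cd p x) d (begin
      cd p x + d       ≤⟨ +-monoʳ-≤ (cd p x) (cd≥d (E231 xyz)) ⟩
      cd p x + cd y z  ≡⟨ trans (K4-cd-sum Q) (sym (K4⇒2d≡n Q)) ⟩
      d + d            ∎))
    (cd≥d pxy)
    where open ≤-Reasoning

  rotate : ∀ {p x y z} → K4 p x y z → K4 p z x y
  rotate = swap₂₃ ∘ swap₃₄

  opposite : ∀ {p x y z} → K4 p x y z → K4 y z p x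
  opposite (pxy , pxz , pyz , xyz) = E231 pyz , E231 xyz , E312 pxy , E312 pxz

  opposite-present : ∀ {p x y z w} → K4 p x y z → ¬ E p x w → E y z w
  opposite-present {w = w} Q ¬pxw = trans (complementary Q w) (cong not (¬-not ¬pxw))

  opposite-absent : ∀ {p x y z w} → K4 p x y z → E p x w → e y z w ≡ false
  opposite-absent {w = w} Q pxw = trans (complementary Q w) (cong not pxw)

  twin : ∀ {p u x y z} → K4 p x y z → K4 u x y z → ∀ v → e u x v ≡ e p x v
  twin Q Q′ v = not-injective (trans (sym (complementary Q′ v)) (complementary Q v))

  -- Links on a K₄ that are stars.

  Star : (p x y z w : Fin n) → Set
  Star p x y z w = E p x w × E p y w × E p z w

  StarFree : (p x y z : Fin n) → Set
  StarFree p x y z = ∀ w → ¬ Star p x y z w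

  star? : ∀ p x y z → (∃[ w ] Star p x y z w) ⊎ StarFree p x y z
  star? p x y z with any? (λ w → (e p x w ≟ᵇ true) ×-dec ((e p y w ≟ᵇ true) ×-dec (e p z w ≟ᵇ true)))
  ... | yes found = inj₁ found
  ... | no none   = inj₂ λ w star → none (w , star)

  -- If `p x w` is an edge, the C₅ is w, v, y, p, x; the case of `p y w` is symmetric. If only
  -- `p z w` is, then `y z w` is an edge because `p x w` is not, and the C₅ is w, y, v, p, z.
  star-exclusive : ∀ {p x y z v w} → K4 p x y z → Star p x y z v → E p x w ⊎ E p y w ⊎ E p z w →
                   E v x w → E v y w → ⊥
  star-exclusive {p} {x} {y} {z} {v} {w} Q@(pxy , _ , _ , _) (pxv , pyv , pzv) meets vxw vyw
    with E-dec p x w | E-dec p y w | meets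
  ... | inj₁ pxw   | _          | _ = no-C5 (E312 vyw) (E321 pyv) (E312 pxy) pxw (E231 vxw)
  ... | inj₂ _     | inj₁ pyw   | _ = no-C5 (E312 vxw) (E321 pxv) (E213 pxy) pyw (E231 vyw)
  ... | inj₂ ¬pxw  | inj₂ _     | inj₁ pxw = ¬pxw pxw
  ... | inj₂ _     | inj₂ ¬pyw  | inj₂ (inj₁ pyw) = ¬pyw pyw
  ... | inj₂ ¬pxw  | inj₂ _     | inj₂ (inj₂ pzw) =
    no-C5 (E321 vyw) (E231 pyv) (E312 pzv) pzw (E231 (opposite-present Q ¬pxw))

  -- If the link of `w` meets `p`, then `star-exclusive` for each two of `x`, `y`, `z` gives the
  -- bound 1. Otherwise that link is the triangle `x y z`, whose indicator appears on the right, and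
  -- the bound is the trivial 3.
  star-codegrees : ∀ {p x y z v} → K4 p x y z → Star p x y z v → ∀ w →
    ι (e v x w) + (ι (e v y w) + ι (e v z w)) ≤ 1 + 2 * ι (e y z w ∧ (e x z w ∧ e x y w))
  star-codegrees {p} {x} {y} {z} {v} Q (pxv , pyv , pzv) w = cases (E-dec p x w) (E-dec p y w) (E-dec p z w)
    where
    Goal : Set
    Goal = ι (e v x w) + (ι (e v y w) + ι (e v z w)) ≤ 1 + 2 * ι (e y z w ∧ (e x z w ∧ e x y w))
    meeting : E p x w ⊎ E p y w ⊎ E p z w → Goal
    meeting m = ≤-trans (at-most-one
      (star-exclusive Q (pxv , pyv , pzv) m)
      (star-exclusive (swap₃₄ Q) (pxv , pzv , pyv) ([ inj₁ , [ inj₂ ∘ inj₂ , inj₂ ∘ inj₁ ]′ ]′ m))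
      (star-exclusive (swap₃₄ (swap₂₃ Q)) (pyv , pzv , pxv) ([ inj₂ ∘ inj₂ , [ inj₁ , inj₂ ∘ inj₁ ]′ ]′ m)))
      (m≤m+n 1 _)
    cases : E p x w ⊎ ¬ E p x w → E p y w ⊎ ¬ E p y w → E p z w ⊎ ¬ E p z w → Goal
    cases (inj₁ pxw) _ _ = meeting (inj₁ pxw)
    cases _ (inj₁ pyw) _ = meeting (inj₂ (inj₁ pyw))
    cases _ _ (inj₁ pzw) = meeting (inj₂ (inj₂ pzw))
    cases (inj₂ ¬pxw) (inj₂ ¬pyw) (inj₂ ¬pzw)
      rewrite opposite-present Q ¬pxw | opposite-present (swap₂₃ Q) ¬pyw | opposite-present (rotate Q) ¬pzw
      = +-mono-≤ (ι≤1 (e v x w)) (+-mono-≤ (ι≤1 (e v y w)) (ι≤1 (e v z w)))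

  star-cd : ∀ {p x y z v} → Star p x y z v → d + (d + d) ≤ cd v x + (cd v y + cd v z)
  star-cd (pxv , pyv , pzv) = +-mono-≤ (cd≥d (E321 pxv)) (+-mono-≤ (cd≥d (E321 pyv)) (cd≥d (E321 pzv)))

  -- Six co-degrees at `v` and `v′` add up to at least 6d, while the pointwise bounds sum to 2n + 2d
  -- = 6d with strict inequality at one vertex.
  no-two-stars : ∀ {p x y z v v′} → K4 p x y z → Star p x y z v → ¬ Star x p y z v′
  no-two-stars {p} {x} {y} {z} {v} {v′} Q S@(pxv , pyv , pzv) S′@(xpv′ , xyv′ , xzv′) =
    <-irrefl refl (begin-strict
      (d + (d + d)) + (d + (d + d))              ≤⟨ +-mono-≤ (star-cd S) (star-cd S′) ⟩
      (cd v x + (cd v y + cd v z)) + (cd v′ p + (cd v′ y + cd v′ z))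
                                                 ≡⟨ trans (∑-distrib-+ A B) (cong₂ _+_ (sum₃ (e v x) (e v y) (e v z)) (sum₃ (e v′ p) (e v′ y) (e v′ z))) ⟨
      sum (λ w → A w + B w)                      <⟨ sum-mono-< {n} pointwise y at-y ⟩
      sum (λ w → 2 + 2 * ι (e y z w))            ≡⟨ trans (∑-distrib-+ {n} (λ _ → 2) (λ w → 2 * ι (e y z w)))
                                                      (cong₂ _+_ (sum-const n 2) (sym (*-distribˡ-sum 2 (ι ∘ e y z)))) ⟩
      n * 2 + 2 * cd y z                         ≡⟨ cong₂ (λ s t → s * 2 + 2 * t) (sym (K4⇒2d≡n Q)) (K4⇒cd≡d (opposite Q)) ⟩
      (d + d) * 2 + 2 * d                        ≡⟨ six d ⟩
      (d + (d + d)) + (d + (d + d))              ∎)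
    where
    open ≤-Reasoning
    A B : Fin n → ℕ
    A w = ι (e v x w) + (ι (e v y w) + ι (e v z w))
    B w = ι (e v′ p w) + (ι (e v′ y w) + ι (e v′ z w))
    six : ∀ k → (k + k) * 2 + 2 * k ≡ (k + (k + k)) + (k + (k + k))
    six = solve-∀
    sum₃ : ∀ (f g h : Fin n → Bool) → sum (λ w → ι (f w) + (ι (g w) + ι (h w))) ≡ sum (ι ∘ f) + (sum (ι ∘ g) + sum (ι ∘ h))
    sum₃ f g h = trans (∑-distrib-+ (ι ∘ f) _) (cong (sum (ι ∘ f) +_) (∑-distrib-+ (ι ∘ g) (ι ∘ h)))
    -- The triangles `x y z` and `p y z` both contain `y z`, but one uses `x y` and the other its
    -- opposite `p z`, so no link contains both.
    disjoint-triangles : ∀ yz xz xy py →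
      (1 + 2 * ι (yz ∧ (xz ∧ xy))) + (1 + 2 * ι (yz ∧ (not xy ∧ py))) ≤ 2 + 2 * ι yz
    disjoint-triangles false _     _     _     = ≤-refl
    disjoint-triangles true  true  true  _     = ≤-refl
    disjoint-triangles true  false true  _     = m≤m+n 2 2
    disjoint-triangles true  true  false true  = ≤-refl
    disjoint-triangles true  false false true  = ≤-refl
    disjoint-triangles true  true  false false = m≤m+n 2 2
    disjoint-triangles true  false false false = m≤m+n 2 2
    pointwise : ∀ w → A w + B w ≤ 2 + 2 * ι (e y z w)
    pointwise w = ≤-trans (+-mono-≤ (star-codegrees Q S w) (star-codegrees (swap₁₂ Q) S′ w))
      (subst (λ b → (1 + 2 * ι (e y z w ∧ (e x z w ∧ e x y w))) + (1 + 2 * ι (e y z w ∧ (b ∧ e p y w))) ≤ 2 + 2 * ι (e y z w))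
        (sym (complementary (opposite (rotate Q)) w)) (disjoint-triangles (e y z w) (e x z w) (e x y w) (e p y w)))
    -- The links of `v` and `v′` are exactly the stars at `p` and `x`, so at `y` all six terms on
    -- the left vanish.
    at-y : A y + B y < 2 + 2 * ι (e y z y)
    at-y rewrite trans e231 (opposite-absent (rotate Q) pzv) | e-xyy v y | trans e321 (opposite-absent Q pxv)
               | trans e231 (opposite-absent (rotate (swap₁₂ Q)) xzv′) | e-xyy v′ y
               | trans e321 (opposite-absent (swap₁₂ Q) xpv′) = s≤s z≤n

  -- An edge through `p` and `u` would give them co-degree at least `d`. But each of their common
  -- neighbours completes `x y` to an edge, and so does `z`, which is not one of them; since `x y`
  -- has co-degree `d`, this is too many.
  twin-not-adjacent : ∀ {p u x y z} → K4 p x y z → K4 u x y z → StarFree z p x y → ∀ w → ¬ E p u w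
  twin-not-adjacent {p} {u} {x} {y} {z} Q@(pxy , _ , _ , xyz) Q′@(uxy , _ , _ , _) free-z w₀ puw₀ =
    <-irrefl refl (≤-<-trans (cd≥d puw₀) (subst (cd p u <_) (K4⇒cd≡d (opposite (rotate Q)))
      (sum-mono-< {n} (λ w → ι-mono (contained w)) z at-z)))
    where
    ι-mono : ∀ {a b} → (a ≡ true → b ≡ true) → ι a ≤ ι b
    ι-mono {false} imp = z≤n
    ι-mono {true}  imp rewrite imp refl = ≤-refl
    -- Since `u x w` is an edge by `twin`, the C₅ would be w, u, x, y, p.
    two-pairs : ∀ {x y z w} → K4 p x y z → K4 u x y z → E p u w → E p x w → ¬ E p y w
    two-pairs {w = w} R@(pxy , _) R′@(uxy , _) puw pxw pyw =
      no-C5 (E312 (trans (twin R R′ w) pxw)) uxy (E231 pxy) (E213 pyw) (E132 puw)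
    contained : ∀ w → E p u w → E x y w
    contained w puw with E-dec p z w
    ... | inj₂ ¬pzw = opposite-present (rotate Q) ¬pzw
    -- By `two-pairs` neither `p y w` nor `p x w` is an edge, so their opposites are, and the link
    -- of `w` would be a star centred at `z`.
    ... | inj₁ pzw  = contradiction
      (E213 pzw ,
       E213 (opposite-present (swap₂₃ Q) λ pyw → two-pairs (rotate (rotate Q)) (rotate (rotate Q′)) puw pyw pzw) ,
       E213 (opposite-present Q λ pxw → two-pairs (rotate Q) (rotate Q′) puw pzw pxw)) (free-z w)
    at-z : ι (e p u z) < ι (e x y z)
    at-z rewrite xyz | trans e132 (opposite-absent (opposite (rotate Q)) (E231 uxy)) = ≤-refl

  -- Parity of `d` when no star is centred at `x`, `y` or `z`.

  module _ {p x y z} (Q : K4 p x y z)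
           (free-x : StarFree x p y z) (free-y : StarFree y p x z) (free-z : StarFree z p x y) where

    private
      K4-without : ∀ {p x y z w} → K4 p x y z → E x y w → E x z w → E y z w → K4 w x y z
      K4-without (_ , _ , _ , xyz) xyw xzw yzw = E312 xyw , E312 xzw , E312 yzw , xyz

      free-z′ : StarFree z x p y
      free-z′ w (zxw , zpw , zyw) = free-z w (zpw , zxw , zyw)

    -- The link of `v` contains `y z`; with no star at `y` or `z` it is the triangle `x y z` or
    -- `p y z`, which makes `v` a twin of `p` or of `x`.
    off-px : ∀ {v} → ¬ E p x v → K4 v x y z ⊎ K4 v p y z
    off-px {v} ¬pxv with E-dec p y v | E-dec p z v
    ... | inj₂ ¬pyv | inj₂ ¬pzv = inj₁ (K4-without Q (opposite-present (rotate Q) ¬pzv) (opposite-present (swap₂₃ Q) ¬pyv) yzv)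
      where yzv = opposite-present Q ¬pxv
    ... | inj₁ pyv  | inj₁ pzv  = inj₂ (K4-without (swap₁₂ Q) pyv pzv yzv)
      where yzv = opposite-present Q ¬pxv
    ... | inj₁ pyv  | inj₂ ¬pzv = contradiction
      (E213 pyv , E213 (opposite-present (rotate Q) ¬pzv) , opposite-present Q ¬pxv) (free-y v)
    ... | inj₂ ¬pyv | inj₁ pzv  = contradiction
      (E213 pzv , E213 (opposite-present (swap₂₃ Q) ¬pyv) , E213 (opposite-present Q ¬pxv)) (free-z v)

    on-px : ∀ {v} → E p x v → ∃[ w ] K4 p x v w
    on-px {v} pxv with E-dec p y v | E-dec p z v
    ... | inj₂ ¬pyv | inj₂ ¬pzv = contradiction
      (E213 pxv , opposite-present (rotate Q) ¬pzv , opposite-present (swap₂₃ Q) ¬pyv) (free-x v)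
    ... | inj₁ pyv  | inj₂ ¬pzv = y , pxv , proj₁ Q , E132 pyv , E132 (opposite-present (rotate Q) ¬pzv)
    ... | inj₂ ¬pyv | inj₁ pzv  = z , pxv , proj₁ (proj₂ Q) , E132 pzv , E132 (opposite-present (swap₂₃ Q) ¬pyv)
    -- The link of `v` is the star centred at `p`, which is allowed. A common neighbour `w` then
    -- serves as fourth vertex: were `p x w` not an edge, `w` would be a twin of `p` or `x` sharing
    -- an edge with it.
    ... | inj₁ pyv  | inj₁ pzv  with common-neighbour (E312 pxv)
    ...   | w , vpw , vxw with E-dec p x w
    ...     | inj₁ pxw  = w , pxv , pxw , E213 vpw , E213 vxw
    ...     | inj₂ ¬pxw with off-px ¬pxw
    ...       | inj₁ Qw = contradiction (E231 vpw) (twin-not-adjacent Q Qw free-z v)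
    ...       | inj₂ Qw = contradiction (E231 vxw) (twin-not-adjacent (swap₁₂ Q) Qw free-z′ v)

    -- If `p x v` is an edge, `on-px` puts `p v` and `x v` into a K₄, and both co-degrees are `d`.
    -- Otherwise `v` is a twin of one of `p`, `x`, with co-degree 0 to that one and `d` to the
    -- other.
    cd-pair : ∀ v → cd p v + cd x v ≡ d * (2 * ι (e p x v) + ι (e y z v))
    cd-pair v with E-dec p x v
    ... | inj₁ pxv rewrite pxv | opposite-absent Q pxv with on-px pxv
    ...   | w , Qw = trans (cong₂ _+_ (K4⇒cd≡d (swap₂₃ Qw)) (K4⇒cd≡d (swap₂₃ (swap₁₂ Qw)))) (double d)
      where
      double : ∀ k → k + k ≡ k * 2
      double = solve-∀
    cd-pair v | inj₂ ¬pxv rewrite ¬-not ¬pxv | opposite-present Q ¬pxv with off-px ¬pxv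
    ... | inj₁ Qv = trans (cong₂ _+_ (sum-none λ w → ¬-not (twin-not-adjacent Q Qv free-z w)) (K4⇒cd≡d (swap₁₂ Qv)))
                          (sym (*-identityʳ d))
    ... | inj₂ Qv = trans (cong₂ _+_ (K4⇒cd≡d (swap₁₂ Qv)) (sum-none λ w → ¬-not (twin-not-adjacent (swap₁₂ Q) Qv free-z′ w)))
                          (trans (+-identityʳ d) (sym (*-identityʳ d)))

    d-even-if-star-free : 2 ∣ d
    -- The total 3d² is split as 2d² + d², so that its evenness passes to d².
    d-even-if-star-free = [ id , id ]′ (euclidsLemma d d prime[2] (∣m+n∣m⇒∣n even (m∣m*n (d * d))))
      where
      open ≡-Reasoning
      spread : ∀ k → k * (2 * k + k) ≡ 2 * (k * k) + k * k
      spread = solve-∀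
      link-sum : ∀ v → 2 ∣ sum (cd v)
      link-sum v = handshake (λ s t → ι (e v s t)) (λ s t → cong ι (sym₂₃ H v s t)) (λ s → cong ι (e-xyy v s))
      total : sum (cd p) + sum (cd x) ≡ 2 * (d * d) + d * d
      total = begin
        sum (cd p) + sum (cd x)                                   ≡⟨ ∑-distrib-+ (cd p) (cd x) ⟨
        sum (λ v → cd p v + cd x v)                               ≡⟨ sum-cong-≗ cd-pair ⟩
        sum (λ v → d * (2 * ι (e p x v) + ι (e y z v)))           ≡⟨ *-distribˡ-sum d (λ v → 2 * ι (e p x v) + ι (e y z v)) ⟨
        d * sum (λ v → 2 * ι (e p x v) + ι (e y z v))             ≡⟨ cong (d *_) (∑-distrib-+ (λ v → 2 * ι (e p x v)) (ι ∘ e y z)) ⟩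
        d * (sum (λ v → 2 * ι (e p x v)) + cd y z)                ≡⟨ cong (λ s → d * (s + cd y z)) (sym (*-distribˡ-sum 2 (ι ∘ e p x))) ⟩
        d * (2 * cd p x + cd y z)                                 ≡⟨ cong₂ (λ s t → d * (2 * s + t)) (K4⇒cd≡d Q) (K4⇒cd≡d (opposite Q)) ⟩
        d * (2 * d + d)                                           ≡⟨ spread d ⟩
        2 * (d * d) + d * d                                       ∎
      even : 2 ∣ 2 * (d * d) + d * d
      even = subst (2 ∣_) total (∣m∣n⇒∣m+n (link-sum p) (link-sum x))

  -- By `no-two-stars`, a star centred at `p` rules out the other three centres.
  d-even-if-star : ∀ {p x y z v} → K4 p x y z → Star p x y z v → 2 ∣ d
  d-even-if-star Q (pxv , pyv , pzv) = d-even-if-star-free Q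
    (λ _ → no-two-stars Q (pxv , pyv , pzv))
    (λ _ → no-two-stars (swap₂₃ Q) (pyv , pxv , pzv))
    (λ _ → no-two-stars (rotate Q) (pzv , pxv , pyv))

  K4⇒d-even : ∀ {p x y z} → K4 p x y z → 2 ∣ d
  K4⇒d-even {p} {x} {y} {z} Q with star? x p y z | star? y p x z | star? z p x y
  ... | inj₁ (_ , S) | _            | _            = d-even-if-star (swap₁₂ Q) S
  ... | inj₂ _       | inj₁ (_ , S) | _            = d-even-if-star (swap₁₂ (swap₂₃ Q)) S
  ... | inj₂ _       | inj₂ _       | inj₁ (_ , S) = d-even-if-star (swap₁₂ (rotate Q)) S
  ... | inj₂ fx      | inj₂ fy      | inj₂ fz      = d-even-if-star-free Q fx fy fz

  extremal : NonEmpty H → d + d ≡ n × 2 ∣ d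
  -- The conclusion is decidable, so a K₄ that exists only up to double negation suffices.
  extremal (x , y , z , xyz) = decidable-stable ((d + d ≟ n) ×-dec (2 ∣? d)) λ not-extremal →
    let w , xyw , xzw = common-neighbour xyz
    in K4⁻⇒¬¬K4 (xyz , xyw , xzw) λ Q → not-extremal (K4⇒2d≡n Q , K4⇒d-even Q)

-- Constructions

_≠ᵇ_ : ∀ {n} → Fin n → Fin n → Bool
x ≠ᵇ y = not (does (x ≟ᶠ y))

≢⇒≠ᵇ : ∀ {n} {x y : Fin n} → x ≢ y → x ≠ᵇ y ≡ true
≢⇒≠ᵇ {x = x} {y} x≢y = cong not (dec-false (x ≟ᶠ y) x≢y)

≠ᵇ⇒≢ : ∀ {n} {x y : Fin n} → x ≠ᵇ y ≡ true → x ≢ y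
≠ᵇ⇒≢ {x = x} {y} x≠y x≡y = contradiction (trans (sym x≠y) (cong not (dec-true (x ≟ᶠ y) x≡y))) λ ()

≠ᵇ-sym : ∀ {n} (x y : Fin n) → x ≠ᵇ y ≡ y ≠ᵇ x
≠ᵇ-sym x y with x ≟ᶠ y
... | yes refl = sym (cong not (dec-true (x ≟ᶠ x) refl))
... | no x≢y   = sym (≢⇒≠ᵇ (x≢y ∘ sym))

∧-true : ∀ {a b} → a ∧ b ≡ true → a ≡ true × b ≡ true
∧-true {true} {true} _ = refl , refl

-- On vertices this excludes degenerate triples; on colours it is the rainbow pattern of the
-- complete 4-partite 3-graph.
distinct³ : ∀ {n} → Fin n → Fin n → Fin n → Bool
distinct³ x y z = x ≠ᵇ y ∧ (y ≠ᵇ z ∧ x ≠ᵇ z)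

distinct³-sym₁₂ : ∀ {n} (x y z : Fin n) → distinct³ x y z ≡ distinct³ y x z
distinct³-sym₁₂ x y z = cong₂ _∧_ (≠ᵇ-sym x y) (∧-comm (y ≠ᵇ z) (x ≠ᵇ z))

distinct³-sym₂₃ : ∀ {n} (x y z : Fin n) → distinct³ x y z ≡ distinct³ x z y
distinct³-sym₂₃ x y z rewrite ≠ᵇ-sym z y = rotate (x ≠ᵇ y) (y ≠ᵇ z) (x ≠ᵇ z)
  where
  rotate : ∀ a b c → a ∧ (b ∧ c) ≡ c ∧ (b ∧ a)
  rotate false b c rewrite ∧-zeroʳ b = sym (∧-zeroʳ c)
  rotate true  b c rewrite ∧-identityʳ b = ∧-comm b c

distinct³-true : ∀ {n} (x y z : Fin n) → distinct³ x y z ≡ true → x ≢ y × y ≢ z × x ≢ z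
distinct³-true x y z h with ∧-true {x ≠ᵇ y} h
... | xy , rest with ∧-true {y ≠ᵇ z} rest
...   | yz , xz = ≠ᵇ⇒≢ xy , ≠ᵇ⇒≢ yz , ≠ᵇ⇒≢ xz

distinct³-intro : ∀ {n} {x y z : Fin n} → x ≢ y → y ≢ z → x ≢ z → distinct³ x y z ≡ true
distinct³-intro xy yz xz rewrite ≢⇒≠ᵇ xy | ≢⇒≠ᵇ yz | ≢⇒≠ᵇ xz = refl

module Coloured {C : Set} (f : C → C → C → Bool)
                (f₁₂ : ∀ a b c → f a b c ≡ f b a c) (f₂₃ : ∀ a b c → f a b c ≡ f a c b)
                {n : ℕ} (col : Fin n → C) where

  graph : 3Graph n
  graph = record
    { edge     = λ x y z → distinct³ x y z ∧ f (col x) (col y) (col z)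
    ; sym₁₂    = λ x y z → cong₂ _∧_ (distinct³-sym₁₂ x y z) (f₁₂ (col x) (col y) (col z))
    ; sym₂₃    = λ x y z → cong₂ _∧_ (distinct³-sym₂₃ x y z) (f₂₃ (col x) (col y) (col z))
    ; distinct = λ x y z h → distinct³-true x y z (proj₁ (∧-true {distinct³ x y z} h))
    }

  edge-colours : ∀ {x y z} → edge graph x y z ≡ true → f (col x) (col y) (col z) ≡ true
  edge-colours {x} {y} {z} h = proj₂ (∧-true {distinct³ x y z} h)

  edge-distinct : ∀ {x y z} → x ≢ y → y ≢ z → x ≢ z → edge graph x y z ≡ f (col x) (col y) (col z)
  edge-distinct xy yz xz rewrite distinct³-intro xy yz xz = refl

Attains : ℕ → ℕ → Set
Attains n m = Σ (3Graph n) λ H → NonEmpty H × ¬ ContainsC5 H × IsMinPosCodeg H m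

exactly-one : Bool → Bool → Bool → Bool
exactly-one true  b c = not b ∧ not c
exactly-one false b c = b xor c

exactly-one₁₂ : ∀ a b c → exactly-one a b c ≡ exactly-one b a c
exactly-one₁₂ true  true  c = refl
exactly-one₁₂ true  false c = refl
exactly-one₁₂ false true  c = refl
exactly-one₁₂ false false c = refl

exactly-one₂₃ : ∀ a b c → exactly-one a b c ≡ exactly-one a c b
exactly-one₂₃ true  b c = ∧-comm (not b) (not c)
exactly-one₂₃ false b c = xor-comm b c

-- Both `a` and `d` are determined by `b` and `c`.
exactly-one-shift : ∀ a b c d → exactly-one a b c ≡ true → exactly-one b c d ≡ true → a ≡ d
exactly-one-shift true  false false true  _ _ = refl
exactly-one-shift false true  false false _ _ = refl
exactly-one-shift false false true  false _ _ = refl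
exactly-one-shift true  true  _     _     () _
exactly-one-shift true  false true  _     () _
exactly-one-shift true  false false false _ ()
exactly-one-shift false true  true  _     () _
exactly-one-shift false true  false true  _ ()
exactly-one-shift false false true  true  _ ()
exactly-one-shift false false false _     () _

sum-prefix : ∀ {n m} → m ≤ n → sum {n} (λ i → ι (toℕ i <ᵇ m)) ≡ m
sum-prefix {n}     {zero}  z≤n       = sum-none {n} (λ _ → refl)
sum-prefix {suc n} {suc m} (s≤s m≤n) = cong suc (sum-prefix m≤n)

sum-point : ∀ {n} (x : Fin n) → sum (λ i → ι (does (x ≟ᶠ i))) ≡ 1
sum-point {suc n} zero    = cong suc (sum-none {n} (λ _ → refl))
sum-point {suc n} (suc x) = sum-point x

≤⇒<ᵇ-false : ∀ {m k} → m ≤ k → (k <ᵇ m) ≡ false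
≤⇒<ᵇ-false z≤n       = refl
≤⇒<ᵇ-false (s≤s m≤k) = ≤⇒<ᵇ-false m≤k

-- Triples with exactly one vertex in a class of size `m`.

module TwoClasses {n m : ℕ} (0<m : 0 < m) (2m<n : m + m < n) where

  inB : Fin n → Bool
  inB i = toℕ i <ᵇ m

  open Coloured exactly-one exactly-one₁₂ exactly-one₂₃ inB

  A≢B : ∀ {x y} → inB x ≡ false → inB y ≡ true → x ≢ y
  A≢B xA yB refl = contradiction (trans (sym xA) yB) λ ()

  codeg-AA : ∀ {x y} → x ≢ y → inB x ≡ false → inB y ≡ false → codeg graph x y ≡ m
  codeg-AA {x} {y} x≢y xA yA = begin
    codeg graph x y                     ≡⟨ codeg-sum graph x y ⟩
    sum (λ z → ι (edge graph x y z))    ≡⟨ sum-cong-≗ (λ z → cong ι (in-B z (inB z) refl)) ⟩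
    sum (λ z → ι (inB z))               ≡⟨ sum-prefix (≤-trans (m≤m+n m m) (<⇒≤ 2m<n)) ⟩
    m                                   ∎
    where
    open ≡-Reasoning
    in-B : ∀ z b → inB z ≡ b → edge graph x y z ≡ inB z
    in-B z true zB = trans (edge-distinct x≢y (A≢B yA zB) (A≢B xA zB))
                           (cong₂ (λ a b → exactly-one a b (inB z)) xA yA)
    in-B z false zA rewrite xA | yA | zA = ∧-zeroʳ (distinct³ x y z)

  -- Every vertex is `x`, or lies in B, or completes the pair to an edge, so the co-degree is at
  -- least n - 1 - m; this is where 2m < n enters.
  codeg-AB : ∀ {x y} → inB x ≡ false → inB y ≡ true → m ≤ codeg graph x y
  codeg-AB {x} {y} xA yB = +-cancelˡ-≤ (1 + m) m _ (begin
    1 + m + m                                                   ≤⟨ 2m<n ⟩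
    n                                                           ≡⟨ trans (sum-const n 1) (*-identityʳ n) ⟨
    sum {n} (λ _ → 1)                                           ≤⟨ sum-mono-≤ {n} (λ z → covered z (x ≟ᶠ z) (inB z) refl) ⟩
    sum (λ z → (ι (does (x ≟ᶠ z)) + ι (inB z)) + ι (edge graph x y z))
      ≡⟨ trans (∑-distrib-+ (λ z → ι (does (x ≟ᶠ z)) + ι (inB z)) _)
           (cong (_+ sum (λ z → ι (edge graph x y z))) (∑-distrib-+ (λ z → ι (does (x ≟ᶠ z))) (λ z → ι (inB z)))) ⟩
    (sum (λ z → ι (does (x ≟ᶠ z))) + sum (λ z → ι (inB z))) + sum (λ z → ι (edge graph x y z))
      ≡⟨ cong₂ _+_ (cong₂ _+_ (sum-point x) (sum-prefix (≤-trans (m≤m+n m m) (<⇒≤ 2m<n)))) (sym (codeg-sum graph x y)) ⟩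
    1 + m + codeg graph x y                                     ∎)
    where
    open ≤-Reasoning
    covered : ∀ z (x≟z : Dec (x ≡ z)) b → inB z ≡ b → 1 ≤ (ι (does x≟z) + ι (inB z)) + ι (edge graph x y z)
    covered z (yes _)  _     _  = s≤s z≤n
    covered z (no _)   true  zB rewrite zB = s≤s z≤n
    covered z (no x≢z) false zA = ≤-trans (≤-reflexive (cong ι (sym is-edge))) (m≤n+m _ _)
      where
      is-edge : edge graph x y z ≡ true
      is-edge = trans (edge-distinct (A≢B xA yB) (A≢B zA yB ∘ sym) x≢z)
                      (trans (cong₂ (λ a b → exactly-one a b (inB z)) xA yB) (cong not zA))

  codeg-BB : ∀ {x y} → inB x ≡ true → inB y ≡ true → codeg graph x y ≡ 0
  codeg-BB {x} {y} xB yB = trans (codeg-sum graph x y) (sum-none no-edge)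
    where
    no-edge : ∀ z → edge graph x y z ≡ false
    no-edge z rewrite xB | yB = ∧-zeroʳ (distinct³ x y z)

  codeg-sym : ∀ x y → codeg graph x y ≡ codeg graph y x
  codeg-sym x y = trans (codeg-sum graph x y)
    (trans (sum-cong-≗ (λ z → cong ι (sym₁₂ graph x y z))) (sym (codeg-sum graph y x)))

  codeg-positive : ∀ x y → x ≢ y → 0 < codeg graph x y → m ≤ codeg graph x y
  codeg-positive x y x≢y pos = cases (inB x) (inB y) refl refl
    where
    cases : ∀ a b → inB x ≡ a → inB y ≡ b → m ≤ codeg graph x y
    cases false false xA yA = ≤-reflexive (sym (codeg-AA x≢y xA yA))
    cases false true  xA yB = codeg-AB xA yB
    cases true  false xB yA = subst (m ≤_) (codeg-sym y x) (codeg-AB yA xB)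
    cases true  true  xB yB = contradiction (subst (0 <_) (codeg-BB xB yB) pos) λ ()

  -- Vertices three apart on a C5 have the same colour; as 3 generates ℤ/5, all five do.
  no-C5-exactly-one : ¬ ContainsC5 graph
  no-C5-exactly-one (a , b , c , d , e , _ , abc , bcd , cde , dea , eab)
    with shift a b c d abc bcd | shift b c d e bcd cde | shift c d e a cde dea | shift d e a b dea eab | edge-colours abc
    where
    shift : ∀ a b c d → edge graph a b c ≡ true → edge graph b c d ≡ true → inB a ≡ inB d
    shift a b c d abc bcd = exactly-one-shift (inB a) (inB b) (inB c) (inB d) (edge-colours abc) (edge-colours bcd)
  ... | a≡d | b≡e | c≡a | d≡b | one rewrite c≡a | sym d≡b | sym a≡d = monochromatic (inB a) one
    where
    monochromatic : ∀ k → exactly-one k k k ≢ true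
    monochromatic true  ()
    monochromatic false ()

  private
    m+1<n : suc m < n
    m+1<n = ≤-trans (+-monoʳ-≤ 1 (+-monoˡ-≤ m 0<m)) 2m<n

    -- The vertices of index 0, `m` and `m` + 1: the first of B and the first two of A.
    b₀ a₁ a₂ : Fin n
    b₀ = fromℕ< (≤-trans (s≤s z≤n) m+1<n)
    a₁ = fromℕ< (<⇒≤ m+1<n)
    a₂ = fromℕ< m+1<n

    b₀∈B : inB b₀ ≡ true
    b₀∈B rewrite toℕ-fromℕ< (≤-trans (s≤s (z≤n {suc m})) m+1<n) = positive 0<m
      where
      positive : ∀ {k} → 0 < k → (0 <ᵇ k) ≡ true
      positive (s≤s _) = refl

    a₁∈A : inB a₁ ≡ false
    a₁∈A rewrite toℕ-fromℕ< (<⇒≤ m+1<n) = ≤⇒<ᵇ-false {m} ≤-refl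

    a₂∈A : inB a₂ ≡ false
    a₂∈A rewrite toℕ-fromℕ< m+1<n = ≤⇒<ᵇ-false {m} (n≤1+n m)

    a₁≢a₂ : a₁ ≢ a₂
    a₁≢a₂ a₁≡a₂ = 1+n≢n (sym (trans (sym (toℕ-fromℕ< (<⇒≤ m+1<n))) (trans (cong toℕ a₁≡a₂) (toℕ-fromℕ< m+1<n))))

  attains : Attains n m
  attains = graph
    , (a₁ , a₂ , b₀ , trans (edge-distinct a₁≢a₂ (A≢B a₂∈A b₀∈B) (A≢B a₁∈A b₀∈B))
                        (trans (cong₂ (λ s t → exactly-one s t (inB b₀)) a₁∈A a₂∈A) b₀∈B))
    , no-C5-exactly-one
    , (a₁ , a₂ , a₁≢a₂ , subst (0 <_) (sym (codeg-AA a₁≢a₂ a₁∈A a₂∈A)) 0<m , codeg-AA a₁≢a₂ a₁∈A a₂∈A)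
    , codeg-positive

-- The complete 4-partite 3-graph.

residue₄ : ℕ → Fin 4
residue₄ 0 = 0F
residue₄ 1 = 1F
residue₄ 2 = 2F
residue₄ 3 = 3F
residue₄ (suc (suc (suc (suc m)))) = residue₄ m

-- As `residue₄` recurses in steps of four, one block of four indices unfolds definitionally.
sum-residue₄ : ∀ k (g : Fin 4 → ℕ) → sum {k * 4} (λ i → g (residue₄ (toℕ i))) ≡ k * sum g
sum-residue₄ zero    g = refl
sum-residue₄ (suc k) g = trans (cong (λ t → g 0F + (g 1F + (g 2F + (g 3F + t)))) (sum-residue₄ k g))
  (regroup (g 0F) (g 1F) (g 2F) (g 3F) (k * sum g))
  where
  regroup : ∀ a b c d t → a + (b + (c + (d + t))) ≡ (a + (b + (c + (d + 0)))) + t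
  regroup = solve-∀

distinct³-completions : ∀ (a b : Fin 4) → a ≢ b → sum (λ c → ι (distinct³ a b c)) ≡ 2
distinct³-completions a b = [ (λ a≡b a≢b → contradiction a≡b a≢b) , (λ eq _ → eq) ]′ (check a b)
  where
  check : ∀ a b → a ≡ b ⊎ sum (λ c → ι (distinct³ a b c)) ≡ 2
  check = toWitness {a? = all? λ a → all? λ b → (a ≟ᶠ b) ⊎-dec (sum (λ c → ι (distinct³ a b c)) ≟ 2)} _

module FourClasses (k : ℕ) where

  col : Fin (suc k * 4) → Fin 4
  col i = residue₄ (toℕ i)

  open Coloured distinct³ distinct³-sym₁₂ distinct³-sym₂₃ col

  edge-col : ∀ x y z → edge graph x y z ≡ distinct³ (col x) (col y) (col z)
  edge-col x y z = cases (distinct³ (col x) (col y) (col z)) refl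
    where
    cases : ∀ b → distinct³ (col x) (col y) (col z) ≡ b → distinct³ x y z ∧ distinct³ (col x) (col y) (col z) ≡ distinct³ (col x) (col y) (col z)
    cases false eq = trans (cong (distinct³ x y z ∧_) eq) (trans (∧-zeroʳ (distinct³ x y z)) (sym eq))
    cases true  eq with distinct³-true (col x) (col y) (col z) eq
    ... | xy , yz , xz = edge-distinct {x} {y} {z} (xy ∘ cong col) (yz ∘ cong col) (xz ∘ cong col)

  edge-rainbow : ∀ x y z → edge graph x y z ≡ true → col x ≢ col y × col y ≢ col z × col x ≢ col z
  edge-rainbow x y z h = distinct³-true (col x) (col y) (col z) (edge-colours {x} {y} {z} h)

  codeg-col : ∀ x y → codeg graph x y ≡ suc k * sum (λ c → ι (distinct³ (col x) (col y) c))
  codeg-col x y = trans (codeg-sum graph x y)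
    (trans (sum-cong-≗ (λ z → cong ι (edge-col x y z))) (sum-residue₄ (suc k) (λ c → ι (distinct³ (col x) (col y) c))))

  codeg-distinct : ∀ {x y} → col x ≢ col y → codeg graph x y ≡ 2 * suc k
  codeg-distinct {x} {y} x≢y = trans (codeg-col x y)
    (trans (cong (suc k *_) (distinct³-completions (col x) (col y) x≢y)) (*-comm (suc k) 2))

  codeg-positive : ∀ x y → x ≢ y → 0 < codeg graph x y → 2 * suc k ≤ codeg graph x y
  codeg-positive x y _ pos = cases (col x ≟ᶠ col y)
    where
    zero-codeg : col x ≡ col y → codeg graph x y ≡ 0
    zero-codeg x≡y = trans (codeg-sum graph x y)
      (sum-none λ z → ¬-not λ h → proj₁ (edge-rainbow x y z h) x≡y)
    cases : Dec (col x ≡ col y) → 2 * suc k ≤ codeg graph x y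
    cases (no x≢y)  = ≤-reflexive (sym (codeg-distinct {x} {y} x≢y))
    cases (yes x≡y) = contradiction (subst (0 <_) (zero-codeg x≡y) pos) λ ()

  -- Any two vertices of a C₅ share an edge, so its five colours would be pairwise distinct.
  C5-colours : ¬ ContainsC5 graph
  C5-colours (a , b , c , d , e , _ , abc , bcd , cde , dea , eab)
    with edge-rainbow a b c abc | edge-rainbow b c d bcd | edge-rainbow c d e cde | edge-rainbow d e a dea | edge-rainbow e a b eab
  ... | a≢b , b≢c , a≢c | _ , c≢d , b≢d | _ , d≢e , c≢e | _ , e≢a , d≢a | _ , _ , e≢b = five (pigeonhole ≤-refl g)
    where
    g : Fin 5 → Fin 4
    g 0F = col a
    g 1F = col b
    g 2F = col c
    g 3F = col d
    g 4F = col e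
    five : ¬ (∃[ i ] ∃[ j ] (i <ᶠ j × g i ≡ g j))
    five (0F , 1F , _ , eq) = a≢b eq
    five (0F , 2F , _ , eq) = a≢c eq
    five (0F , 3F , _ , eq) = d≢a (sym eq)
    five (0F , 4F , _ , eq) = e≢a (sym eq)
    five (1F , 2F , _ , eq) = b≢c eq
    five (1F , 3F , _ , eq) = b≢d eq
    five (1F , 4F , _ , eq) = e≢b (sym eq)
    five (2F , 3F , _ , eq) = c≢d eq
    five (2F , 4F , _ , eq) = c≢e eq
    five (3F , 4F , _ , eq) = d≢e eq
    five (1F , 1F , s≤s () , _)
    five (2F , 1F , s≤s () , _)
    five (2F , 2F , s≤s (s≤s ()) , _)
    five (3F , 1F , s≤s () , _)
    five (3F , 2F , s≤s (s≤s ()) , _)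
    five (3F , 3F , s≤s (s≤s (s≤s ())) , _)
    five (4F , 1F , s≤s () , _)
    five (4F , 2F , s≤s (s≤s ()) , _)
    five (4F , 3F , s≤s (s≤s (s≤s ())) , _)
    five (4F , 4F , s≤s (s≤s (s≤s (s≤s ()))) , _)

  attains : Attains (suc k * 4) (2 * suc k)
  attains = graph , (0F , 1F , 2F , refl) , C5-colours
    , (0F , 1F , (λ ()) , subst (0 <_) (sym (codeg-distinct {0F} {1F} λ ())) (s≤s z≤n) , codeg-distinct {0F} {1F} λ ())
    , codeg-positive

-- Residues modulo 4 and the final count.

m+m≤1+n+n⇒m≤n : ∀ {m n} → m + m ≤ 1 + (n + n) → m ≤ n
m+m≤1+n+n⇒m≤n {m} {n} h = ≮⇒≥ λ n<m →
  <-irrefl refl (≤-trans (≤-reflexive (cong suc (sym (+-suc n n)))) (≤-trans (+-mono-≤ n<m n<m) h))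

-- Once n ≤ 2d, `extremal` forces equality, so 2d never exceeds n.
C5-free-bound : ∀ {n} (H : 3Graph n) d → NonEmpty H → ¬ ContainsC5 H → IsMinPosCodeg H d →
                d + d ≤ n × (d + d ≡ n → 2 ∣ d)
C5-free-bound {n} H d nonEmpty free (_ , codeg≥d) = bound , λ eq → proj₂ (extremal′ (≤-reflexive (sym eq)))
  where
  extremal′ : n ≤ d + d → d + d ≡ n × 2 ∣ d
  extremal′ n≤2d = C5Free.extremal H free d codeg≥d n≤2d nonEmpty
  bound : d + d ≤ n
  bound with ≤-total n (d + d)
  ... | inj₁ n≤2d = ≤-reflexive (proj₁ (extremal′ n≤2d))
  ... | inj₂ 2d≤n = 2d≤n

q*4≡2q+2q : ∀ q → q * 4 ≡ 2 * q + 2 * q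
q*4≡2q+2q = solve-∀

2+q*4≡ : ∀ q → 2 + q * 4 ≡ (1 + 2 * q) + (1 + 2 * q)
2+q*4≡ = solve-∀

3+q*4≡ : ∀ q → 3 + q * 4 ≡ 1 + ((2 * q + 1) + (2 * q + 1))
3+q*4≡ = solve-∀

even-bound : ∀ r q d → r < 4 → r ≢ 3 → d + d ≤ r + q * 4 → (d + d ≡ r + q * 4 → 2 ∣ d) → d ≤ 2 * q
even-bound 0 q d _ _ le _ = m+m≤1+n+n⇒m≤n (≤-trans le (≤-trans (≤-reflexive (q*4≡2q+2q q)) (n≤1+n _)))
even-bound 1 q d _ _ le _ = m+m≤1+n+n⇒m≤n (≤-trans le (≤-reflexive (cong suc (q*4≡2q+2q q))))
even-bound 2 q d _ _ le even
  with m≤n⇒m<n∨m≡n (m+m≤1+n+n⇒m≤n {d} {1 + 2 * q} (≤-trans le (≤-trans (≤-reflexive (2+q*4≡ q)) (n≤1+n _))))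
... | inj₁ (s≤s d≤2q) = d≤2q
-- Here d = 2q + 1 gives 2d = n, so `d` would have to be even.
... | inj₂ refl = contradiction
  (∣⇒≤ (∣m+n∣m⇒∣n (subst (2 ∣_) (+-comm 1 (2 * q)) (even (sym (2+q*4≡ q)))) (m∣m*n q))) λ { (s≤s ()) }
even-bound 3 q d _ r≢3 _ _ = contradiction refl r≢3
even-bound (suc (suc (suc (suc _)))) q d (s≤s (s≤s (s≤s (s≤s ())))) _ _ _

odd-bound : ∀ q d → d + d ≤ 3 + q * 4 → d ≤ 2 * q + 1
odd-bound q d le = m+m≤1+n+n⇒m≤n (≤-trans le (≤-reflexive (3+q*4≡ q)))

-- With m = 2q, `TwoClasses` requires 4q < n, which fails for residue 0; there four classes of size
-- `q` give co-degree 2q.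
even-attained : ∀ r q → r < 4 → r ≢ 3 → 0 < q → Attains (r + q * 4) (2 * q)
even-attained 0 (suc k) _ _ _ = FourClasses.attains k
even-attained 1 (suc k) _ _ _ = TwoClasses.attains (s≤s z≤n) (≤-reflexive (cong suc (sym (q*4≡2q+2q (suc k)))))
even-attained 2 (suc k) _ _ _ =
  TwoClasses.attains (s≤s z≤n) (≤-trans (≤-reflexive (cong suc (sym (q*4≡2q+2q (suc k))))) (n≤1+n _))
even-attained 3 q _ r≢3 _ = contradiction refl r≢3
even-attained (suc (suc (suc (suc _)))) q (s≤s (s≤s (s≤s (s≤s ())))) _ _

odd-attained : ∀ q → Attains (3 + q * 4) (2 * q + 1)
odd-attained q = TwoClasses.attains (m≤n+m 1 (2 * q)) (≤-reflexive (sym (3+q*4≡ q)))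

theorem2 : ∀ (n : ℕ) → 6 ≤ n →
    (n % 4 ≢ 3 → CoPosExC5≡ n (2 * (n / 4)))
    × (n % 4 ≡ 3 → CoPosExC5≡ n (2 * (n / 4) + 1))
theorem2 n 6≤n =
  (λ r≢3 → subst (λ N → Attains N (2 * q)) (sym n≡) (even-attained (n % 4) q r<4 r≢3 0<q) ,
           λ H d nonEmpty free min → let 2d≤n , even = C5-free-bound H d nonEmpty free min in
             even-bound (n % 4) q d r<4 r≢3 (subst (d + d ≤_) n≡ 2d≤n) (λ eq → even (trans eq (sym n≡)))) ,
  (λ r≡3 → let n≡3+4q = trans n≡ (cong (_+ q * 4) r≡3) in
           subst (λ N → Attains N (2 * q + 1)) (sym n≡3+4q) (odd-attained q) ,
           λ H d nonEmpty free min →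
             odd-bound q d (subst (d + d ≤_) n≡3+4q (proj₁ (C5-free-bound H d nonEmpty free min))))
  where
  q : ℕ
  q = n / 4
  n≡ : n ≡ n % 4 + q * 4
  n≡ = m≡m%n+[m/n]*n n 4
  r<4 : n % 4 < 4
  r<4 = m%n<n n 4
  0<q : 0 < q
  0<q = m≥n⇒m/n>0 {n} {4} (≤-trans (m≤m+n 4 2) 6≤n)
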